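{- For every sufficiently large integer $n$, there exists a real matrix with $\lfloor n^{2}/6\rfloor$ rows and $2^{2^{\lfloor n/(2\log_2 n)\rfloor}}$ columns that contains no $n\times n$ row-monotone submatrix.
   Context: An $n\times n$ submatrix of a real matrix $A$ is obtained by choosing row indices $i_1<\dots<i_n$ and column indices $j_1<\dots<j_n$ and taking $B(k,l)=A(i_k,j_l)$. A matrix is row-monotone if either every row is monotone increasing or every row is monotone decreasing. -}

module Defs where

open import Data.Nat using (ℕ; suc; _*_; _^_; _<_) renaming (_≤_ to _≤ℕ_)
open import Data.Fin using (Fin) renaming (_<_ to _<ᶠ_; _≤_ to _≤ᶠ_)
open import Data.Integer using (ℤ; _≤_)
open import Data.Sum using (_⊎_)
open import Data.Product using (Σ; _×_)

Matrix : ℕ → ℕ → Set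
Matrix r c = Fin r → Fin c → ℤ

StrictlyIncreasing : ∀ {n m} → (Fin n → Fin m) → Set
StrictlyIncreasing {n} f = ∀ (k l : Fin n) → k <ᶠ l → f k <ᶠ f l

submatrix : ∀ {r c n} → Matrix r c → (Fin n → Fin r) → (Fin n → Fin c) → Matrix n n
submatrix A i j k l = A (i k) (j l)

RowMonotone : ∀ {m n} → Matrix m n → Set
RowMonotone {m} {n} B =
  (∀ (k : Fin m) (l l' : Fin n) → l ≤ᶠ l' → B k l ≤ B k l')
  ⊎ (∀ (k : Fin m) (l l' : Fin n) → l ≤ᶠ l' → B k l' ≤ B k l)

HasRowMonotoneSubmatrix : ∀ {r c} → ℕ → Matrix r c → Set
HasRowMonotoneSubmatrix {r} {c} n A =
  Σ (Fin n → Fin r) λ i → Σ (Fin n → Fin c) λ j →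
    StrictlyIncreasing i × StrictlyIncreasing j × RowMonotone (submatrix A i j)

-- k = ⌊ n / (2 log₂ n) ⌋ for n ≥ 2, characterised without real logarithms:
-- 2k·log₂ n ≤ n  ⇔  n^(2k) ≤ 2^n.
IsFloorNOver2Log2N : ℕ → ℕ → Set
IsFloorNOver2Log2N n k = (n ^ (2 * k) ≤ℕ 2 ^ n) × (2 ^ n < n ^ (2 * suc k))

{-# OPTIONS --safe #-}
module Submission where

-- Label the columns by binary words of length L = 2 ^ k and give every row r a sign vector
-- s r ∈ {±}^L; row r orders the columns lexicographically, reversing each level where s r is
-- negative.  Any n columns contain, for d = ⌈log₂ n⌉ levels i, a pair that first differs at
-- level i, so an n × n row-monotone submatrix forces the signs to be constant on an n × d grid
-- of rows and levels.  There are C(R, n) C(L, d) grids, R = ⌊n² / 6⌋, and a random sign matrix is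
-- constant on a given one with probability 2 · 2^(-nd).  Since n! ≥ (n/3)^n and 2^d ≥ n, we have
-- C(R, n) ≤ 2^(nd - n), while 2 C(L, d) ≤ 2^(kd + 1) < 2^n because 2k log₂ n ≤ n.

open import Defs
open import Data.Nat using (ℕ; zero; suc; _+_; _*_; _^_; _≤_; _<_; _!; z≤n; s≤s; z<s)
open import Data.Nat.DivMod using (_/_; m/n*n≤m)
open import Data.Nat.ListAction using (sum)
open import Data.Nat.Properties
open import Data.Nat.Tactic.RingSolver using (solve-∀)
open import Data.Bool using (Bool; true; false; not; if_then_else_)
open import Data.Bool.Properties using (¬-not)
import Data.Empty as Empty
open import Data.Fin using (Fin; zero; suc; toℕ; combine; quotient; remainder)
import Data.Fin as Fin
import Data.Fin.Properties as Fin
open import Data.Fin.Subset using (Subset; inside; outside; ∣_∣; ⊥)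
import Data.Fin.Subset as Subset
open import Data.Fin.Subset.Properties using (∉⊥; ∣⊥∣≡0)
import Data.Integer as ℤ
open import Data.Integer.Properties using (drop‿+≤+)
open import Data.List using (List; []; _∷_; length; map; _++_; cartesianProduct; cartesianProductWith)
import Data.List as List
open import Data.List.Membership.Propositional using (_∈_)
open import Data.List.Membership.Propositional.Properties
  using (∈-tabulate⁻; ∈-map⁺; ∈-++⁺ˡ; ∈-++⁺ʳ; ∈-cartesianProduct⁺; ∈-cartesianProduct⁻;
         ∈-cartesianProductWith⁺; ∈-cartesianProductWith⁻)
open import Data.List.Properties using (length-++; length-map; length-tabulate)
open import Data.List.Relation.Unary.All as All using (All; []; _∷_)
import Data.List.Relation.Unary.All.Properties as All
open import Data.List.Relation.Unary.Any using (here; there)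
open import Data.List.Relation.Unary.Unique.Propositional using (Unique; []; _∷_)
import Data.List.Relation.Unary.Unique.Propositional.Properties as Unique
import Data.Product as Product
open import Data.Product using (Σ; ∃; ∃₂; _×_; _,_; proj₂)
import Data.Sum as Sum
open import Data.Sum using (_⊎_; inj₁; inj₂; [_,_]′)
open import Data.Vec using (Vec; []; _∷_; lookup; zipWith; concat; here; there)
import Data.Vec as Vec
open import Data.Vec.Properties using (lookup-map; lookup-concat; lookup∘tabulate; []=⇒lookup; lookup⇒[]=)
open import Function using (_∘_; id)
open import Relation.Binary.Definitions using (tri<; tri≈; tri>)
open import Relation.Binary.PropositionalEquality
open import Relation.Nullary using (¬_; yes; no; contradiction)

private variable
  L N : ℕ

double : ∀ m → 2 * m ≡ m + m
double = solve-∀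

-- Binary words, lexicographic order and sign flips

bit : Bool → ℕ
bit false = 0
bit true  = 1

binary : Vec Bool L → ℕ
binary []                = 0
binary {suc L} (b ∷ u) = 2 ^ L * bit b + binary u

binary<2^ : (u : Vec Bool L) → binary u < 2 ^ L
binary<2^ [] = z<s
binary<2^ {suc L} (false ∷ u) rewrite *-zeroʳ (2 ^ L) =
  <-≤-trans (binary<2^ u) (m≤m+n (2 ^ L) _)
binary<2^ {suc L} (true ∷ u) rewrite *-identityʳ (2 ^ L) | double (2 ^ L) =
  +-monoʳ-< (2 ^ L) (binary<2^ u)

-- The lexicographic order on words, refined by the level of the first difference; the digits after
-- that level are arbitrary.
data Splits : Fin L → Vec Bool L → Vec Bool L → Set where
  here  : {u v : Vec Bool L} → Splits zero (false ∷ u) (true ∷ v)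
  there : ∀ {i b} {u v : Vec Bool L} → Splits i u v → Splits (suc i) (b ∷ u) (b ∷ v)

Splits⇒binary< : ∀ {i} {u v : Vec Bool L} → Splits i u v → binary u < binary v
Splits⇒binary< {suc L} (here {u = u} {v})
  rewrite *-zeroʳ (2 ^ L) | *-identityʳ (2 ^ L) =
  <-≤-trans (binary<2^ u) (m≤m+n (2 ^ L) (binary v))
Splits⇒binary< {suc L} (there {b = b} p) = +-monoʳ-< (2 ^ L * bit b) (Splits⇒binary< p)

orient : Bool → Bool → Bool
orient true  b = b
orient false b = not b

-- Flipping by signs changes a common prefix in the same way in both words, so the first difference
-- stays at level `i`, and only the sign at `i` decides which word comes first.
Splits-orient : ∀ {i} (s : Vec Bool L) {u v} → Splits i u v → lookup s i ≡ true →
  Splits i (zipWith orient s u) (zipWith orient s v)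
Splits-orient (_ ∷ s) here      refl = here
Splits-orient (_ ∷ s) (there p) eq   = there (Splits-orient s p eq)

Splits-orient-flip : ∀ {i} (s : Vec Bool L) {u v} → Splits i u v → lookup s i ≡ false →
  Splits i (zipWith orient s v) (zipWith orient s u)
Splits-orient-flip (_ ∷ s) here      refl = here
Splits-orient-flip (_ ∷ s) (there p) eq   = there (Splits-orient-flip s p eq)

digit : Fin 2 → Bool
digit zero       = false
digit (suc zero) = true

bit-digit : ∀ q → bit (digit q) ≡ toℕ q
bit-digit zero       = refl
bit-digit (suc zero) = refl

code : Fin (2 ^ L) → Vec Bool L
code {zero}  c = []
code {suc L} c = digit (quotient {2} (2 ^ L) c) ∷ code {L} (remainder {2} (2 ^ L) c)

-- Makes `code` injective and turns the order of the columns into the lexicographic order of their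
-- words.
binary-code : ∀ L (c : Fin (2 ^ L)) → binary (code {L} c) ≡ toℕ c
binary-code zero zero = refl
binary-code (suc L) c = begin
  2 ^ L * bit (digit q) + binary (code {L} r) ≡⟨ cong₂ (λ x y → 2 ^ L * x + y) (bit-digit q) (binary-code L r) ⟩
  2 ^ L * toℕ q + toℕ r                   ≡⟨ Fin.toℕ-combine q r ⟨
  toℕ (combine q r)                       ≡⟨ cong toℕ (Fin.combine-remQuot {2} (2 ^ L) c) ⟩
  toℕ c                                   ∎
  where
  open ≡-Reasoning
  q = quotient {2} (2 ^ L) c
  r = remainder {2} (2 ^ L) c

-- Levels at which a set of words splits

tails : Bool → List (Vec Bool (suc L)) → List (Vec Bool L)
tails b     []                 = []
tails true  ((true  ∷ u) ∷ xs) = u ∷ tails true xs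
tails true  ((false ∷ u) ∷ xs) = tails true xs
tails false ((true  ∷ u) ∷ xs) = tails false xs
tails false ((false ∷ u) ∷ xs) = u ∷ tails false xs

∈-tails : ∀ b {u : Vec Bool L} xs → u ∈ tails b xs → (b ∷ u) ∈ xs
∈-tails true  ((true  ∷ _) ∷ xs) (here refl) = here refl
∈-tails true  ((true  ∷ _) ∷ xs) (there p)   = there (∈-tails true xs p)
∈-tails true  ((false ∷ _) ∷ xs) p           = there (∈-tails true xs p)
∈-tails false ((true  ∷ _) ∷ xs) p           = there (∈-tails false xs p)
∈-tails false ((false ∷ _) ∷ xs) (here refl) = here refl
∈-tails false ((false ∷ _) ∷ xs) (there p)   = there (∈-tails false xs p)

length-tails : (xs : List (Vec Bool (suc L))) →
  length (tails false xs) + length (tails true xs) ≡ length xs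
length-tails []                 = refl
length-tails ((true  ∷ _) ∷ xs) = trans (+-suc _ _) (cong suc (length-tails xs))
length-tails ((false ∷ _) ∷ xs) = cong suc (length-tails xs)

unique-tails : ∀ b {xs : List (Vec Bool (suc L))} → Unique xs → Unique (tails b xs)
unique-tails b {[]} [] = []
unique-tails true  {(true  ∷ u) ∷ xs} (x∉ ∷ uniq) =
  All.tabulate (λ p eq → All.lookup x∉ (∈-tails true xs p) (cong (true ∷_) eq)) ∷ unique-tails true uniq
unique-tails true  {(false ∷ u) ∷ xs} (x∉ ∷ uniq) = unique-tails true uniq
unique-tails false {(true  ∷ u) ∷ xs} (x∉ ∷ uniq) = unique-tails false uniq
unique-tails false {(false ∷ u) ∷ xs} (x∉ ∷ uniq) =
  All.tabulate (λ p eq → All.lookup x∉ (∈-tails false xs p) (cong (false ∷_) eq)) ∷ unique-tails false uniq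

SplitBy : List (Vec Bool L) → Fin L → Set
SplitBy xs i = ∃₂ λ x y → x ∈ xs × y ∈ xs × Splits i x y

SplitBy-tails : ∀ b {xs : List (Vec Bool (suc L))} {i} → SplitBy (tails b xs) i → SplitBy xs (suc i)
SplitBy-tails b {xs} (x , y , x∈ , y∈ , p) = b ∷ x , b ∷ y , ∈-tails b xs x∈ , ∈-tails b xs y∈ , there p

unique-[]-length : (xs : List (Vec Bool 0)) → Unique xs → length xs ≤ 1
unique-[]-length []             _                = z≤n
unique-[]-length (_ ∷ [])       _                = s≤s z≤n
unique-[]-length ([] ∷ [] ∷ _)  ((x≢y ∷ _) ∷ _) = contradiction refl x≢y

larger-half : ∀ m a b → 2 * m < 2 * (a + b) → (m < 2 * a) ⊎ (m < 2 * b)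
larger-half m a b lt with ≤-total a b
... | inj₁ a≤b = inj₂ (<-≤-trans (*-cancelˡ-< 2 _ _ lt) (≤-trans (+-monoˡ-≤ b a≤b) (≤-reflexive (sym (double b)))))
... | inj₂ b≤a = inj₁ (<-≤-trans (*-cancelˡ-< 2 _ _ lt) (≤-trans (+-monoʳ-≤ a b≤a) (≤-reflexive (sym (double a)))))

-- If one of the two halves is empty, the other has full size; otherwise the heads of the two halves
-- differ at the first level.
top-level : (xs : List (Vec Bool (suc L))) →
  (∃ λ b → length (tails b xs) ≡ length xs) ⊎ SplitBy xs zero
top-level xs with tails false xs in eq₀ | tails true xs in eq₁ | length-tails xs
... | []    | _     | len = inj₁ (true , trans (cong length eq₁) len)
... | _ ∷ _ | []    | len = inj₁ (false , trans (cong length eq₀) (trans (sym (+-identityʳ _)) len))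
... | u ∷ _ | v ∷ _ | len = inj₂ (false ∷ u , true ∷ v , head∈ false eq₀ , head∈ true eq₁ , here)
  where
  head∈ : ∀ b {w ws} → tails b xs ≡ w ∷ ws → (b ∷ w) ∈ xs
  head∈ b eq = ∈-tails b xs (subst (_ ∈_) (sym eq) (here refl))

-- At a level that splits xs, recurse into the larger half only: so the size at most halves
-- for each level collected.
splitting-levels : ∀ d (xs : List (Vec Bool L)) → Unique xs → 2 ^ d < 2 * length xs →
  Σ (Subset L) λ D → ∣ D ∣ ≡ d × (∀ {i} → i Subset.∈ D → SplitBy xs i)
splitting-levels {L} zero xs uniq lt = ⊥ , ∣⊥∣≡0 L , λ i∈ → contradiction i∈ ∉⊥
-- There is only one word of length 0, but the hypothesis asks for more than `2 ^ d` distinct ones.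
splitting-levels {zero} (suc d) xs uniq lt =
  contradiction (<-≤-trans (*-cancelˡ-< 2 _ _ lt) (unique-[]-length xs uniq)) (≤⇒≯ (m^n>0 2 d))
splitting-levels {suc L} (suc d) xs uniq lt with top-level xs
... | inj₁ (b , len)
  with D , size , split ← splitting-levels (suc d) (tails b xs) (unique-tails b uniq)
         (subst (λ l → 2 ^ suc d < 2 * l) (sym len) lt)
  = outside ∷ D , size , λ { (there i∈) → SplitBy-tails b (split i∈) }
... | inj₂ split₀ = [ extend false , extend true ]′
    (larger-half (2 ^ d) (length (tails false xs)) (length (tails true xs)) (subst (λ l → 2 ^ suc d < 2 * l) (sym (length-tails xs)) lt))
  where
  extend : ∀ b → 2 ^ d < 2 * length (tails b xs) →
    Σ (Subset (suc L)) λ D → ∣ D ∣ ≡ suc d × (∀ {i} → i Subset.∈ D → SplitBy xs i)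
  extend b lt
    with D , size , split ← splitting-levels d (tails b xs) (unique-tails b uniq) lt
    = inside ∷ D , cong suc size , λ { here → split₀ ; (there i∈) → SplitBy-tails b (split i∈) }

-- Union bound for constant sets of positions, derandomized

-- The event (b , Q): a random Boolean vector is constantly b on the positions in Q.
Event : ℕ → Set
Event N = Bool × Subset N

Avoids : Vec Bool N → Event N → Set
Avoids v (b , Q) = ∃ λ p → p Subset.∈ Q × lookup v p ≢ b

-- The number of vectors that are constant on Q with a prescribed value.
free : Subset N → ℕ
free []            = 1
free (inside  ∷ Q) = free Q
free (outside ∷ Q) = 2 * free Q

free-size : (Q : Subset N) → free Q * 2 ^ ∣ Q ∣ ≡ 2 ^ N
free-size []            = refl
free-size (inside  ∷ Q) = trans (swap (free Q) (2 ^ ∣ Q ∣)) (cong (2 *_) (free-size Q))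
  where
  swap : ∀ x y → x * (2 * y) ≡ 2 * (x * y)
  swap = solve-∀
free-size (outside ∷ Q) = trans (*-assoc 2 (free Q) _) (cong (2 *_) (free-size Q))

total : List (Event N) → ℕ
total = sum ∘ map (free ∘ proj₂)

-- Each event has probability `2 ^ t` in the denominator, so fewer than `2 ^ t` events have total
-- probability below 1.
total-uniform : ∀ {t} (es : List (Event N)) → All (λ e → ∣ proj₂ e ∣ ≡ t) es →
  total es * 2 ^ t ≡ length es * 2 ^ N
total-uniform []             []           = refl
total-uniform {N} ((_ , Q) ∷ es) (refl ∷ all) = begin
  (free Q + total es) * 2 ^ ∣ Q ∣           ≡⟨ *-distribʳ-+ (2 ^ ∣ Q ∣) (free Q) _ ⟩
  free Q * 2 ^ ∣ Q ∣ + total es * 2 ^ ∣ Q ∣ ≡⟨ cong₂ _+_ (free-size Q) (total-uniform es all) ⟩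
  2 ^ N + length es * 2 ^ N                 ∎
  where open ≡-Reasoning

-- Conditioning on the first coordinate being `c`: an event that needs the other value there has
-- become impossible and is dropped.
restrict : Bool → List (Event (suc N)) → List (Event N)
restrict c     []                         = []
restrict c     ((b , outside ∷ Q) ∷ es)   = (b , Q) ∷ restrict c es
restrict true  ((true , inside ∷ Q) ∷ es)  = (true , Q) ∷ restrict true es
restrict true  ((false , inside ∷ Q) ∷ es) = restrict true es
restrict false ((true , inside ∷ Q) ∷ es)  = restrict false es
restrict false ((false , inside ∷ Q) ∷ es) = (false , Q) ∷ restrict false es

-- An event that leaves the first coordinate free contributes equally to both branches; any other
-- survives in exactly one.
total-restrict : (es : List (Event (suc N))) →
  total es ≡ total (restrict false es) + total (restrict true es)
total-restrict [] = refl
total-restrict ((b , outside ∷ Q) ∷ es) rewrite total-restrict es = regroup (free Q) _ _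
  where
  regroup : ∀ x y z → 2 * x + (y + z) ≡ (x + y) + (x + z)
  regroup = solve-∀
total-restrict ((true , inside ∷ Q) ∷ es) rewrite total-restrict es = regroup (free Q) (total (restrict false es)) _
  where
  regroup : ∀ x y z → x + (y + z) ≡ y + (x + z)
  regroup = solve-∀
total-restrict ((false , inside ∷ Q) ∷ es) rewrite total-restrict es = sym (+-assoc (free Q) _ _)

avoids-there : ∀ {c b s Q} {v : Vec Bool N} → Avoids v (b , Q) → Avoids (c ∷ v) (b , s ∷ Q)
avoids-there (p , p∈ , v≢) = suc p , there p∈ , v≢

avoids-restrict : ∀ c {v : Vec Bool N} es → All (Avoids v) (restrict c es) → All (Avoids (c ∷ v)) es
avoids-restrict c     []                          all       = []
avoids-restrict c     ((b , outside ∷ Q) ∷ es)    (a ∷ all) = avoids-there a ∷ avoids-restrict c es all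
avoids-restrict true  ((true , inside ∷ Q) ∷ es)  (a ∷ all) = avoids-there a ∷ avoids-restrict true es all
avoids-restrict true  ((false , inside ∷ Q) ∷ es) all       = (zero , here , λ ()) ∷ avoids-restrict true es all
avoids-restrict false ((true , inside ∷ Q) ∷ es)  all       = (zero , here , λ ()) ∷ avoids-restrict false es all
avoids-restrict false ((false , inside ∷ Q) ∷ es) (a ∷ all) = avoids-there a ∷ avoids-restrict false es all

+<double : ∀ m a b → a + b < 2 * m → a < m ⊎ b < m
+<double m a b lt with a <? m | b <? m
... | yes a<m | _       = inj₁ a<m
... | no  _   | yes b<m = inj₂ b<m
... | no  a≮m | no b≮m  = contradiction (+-mono-≤ (≮⇒≥ a≮m) (≮⇒≥ b≮m)) (<⇒≱ (subst (a + b <_) (double m) lt))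

-- Method of conditional expectations: fix the coordinates one at a time, never letting the
-- number of bad completions, counted with multiplicity, reach the number of completions.
avoiding : (es : List (Event N)) → total es < 2 ^ N → ∃ λ v → All (Avoids v) es
avoiding {zero}  []             _  = [] , []
avoiding {zero}  ((_ , []) ∷ _) (s≤s ())
avoiding {suc N} es             lt with +<double (2 ^ N) _ _ (subst (_< 2 ^ suc N) (total-restrict es) lt)
... | inj₁ lt₀ with v , all ← avoiding (restrict false es) lt₀ = false ∷ v , avoids-restrict false es all
... | inj₂ lt₁ with v , all ← avoiding (restrict true es) lt₁ = true ∷ v , avoids-restrict true es all

-- Enumerating and counting subsets of a given size

subsets : ∀ N → ℕ → List (Subset N)
subsets zero    zero    = [] ∷ []
subsets zero    (suc k) = []
subsets (suc N) zero    = map (outside ∷_) (subsets N zero)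
subsets (suc N) (suc k) = map (inside ∷_) (subsets N k) ++ map (outside ∷_) (subsets N (suc k))

∈-subsets⁺ : (S : Subset N) → S ∈ subsets N ∣ S ∣
∈-subsets⁺ []            = here refl
∈-subsets⁺ (inside  ∷ S) = ∈-++⁺ˡ (∈-map⁺ _ (∈-subsets⁺ S))
∈-subsets⁺ (outside ∷ S) with ∣ S ∣ | ∈-subsets⁺ S
... | zero  | S∈ = ∈-map⁺ _ S∈
... | suc k | S∈ = ∈-++⁺ʳ (map (inside ∷_) (subsets _ k)) (∈-map⁺ _ S∈)

subsets-size : ∀ N k → All (λ S → ∣ S ∣ ≡ k) (subsets N k)
subsets-size zero    zero    = refl ∷ []
subsets-size zero    (suc k) = []
subsets-size (suc N) zero    = All.map⁺ (subsets-size N zero)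
subsets-size (suc N) (suc k) =
  All.++⁺ (All.map⁺ (All.map (cong suc) (subsets-size N k))) (All.map⁺ (subsets-size N (suc k)))

-- The two leading terms of the binomial expansion. It is what Pascal's rule leaves to prove in the
-- inductive step of `length-subsets`.
bernoulli : ∀ m k → suc k * m ^ k + m ^ suc k ≤ suc m ^ suc k
bernoulli m zero    = ≤-reflexive (identity m)
  where
  identity : ∀ m → 1 * 1 + m * 1 ≡ (1 + m) * 1
  identity = solve-∀
bernoulli m (suc k) = begin
  (2 + k) * (m * m ^ k) + m * (m * m ^ k)              ≤⟨ m≤m+n _ (suc k * m ^ k) ⟩
  (2 + k) * (m * m ^ k) + m * (m * m ^ k) + suc k * m ^ k ≡⟨ identity m k (m ^ k) ⟩
  suc m * (suc k * m ^ k + m * m ^ k)                  ≤⟨ *-monoʳ-≤ (suc m) (bernoulli m k) ⟩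
  suc m * suc m ^ suc k                                ∎
  where
  open ≤-Reasoning
  identity : ∀ m k x → (2 + k) * (m * x) + m * (m * x) + (1 + k) * x ≡ (1 + m) * ((1 + k) * x + m * x)
  identity = solve-∀

length-subsets-suc : ∀ N k →
  length (subsets (suc N) (suc k)) ≡ length (subsets N k) + length (subsets N (suc k))
length-subsets-suc N k = trans (length-++ (map (inside ∷_) (subsets N k)))
  (cong₂ _+_ (length-map (inside ∷_) (subsets N k)) (length-map (outside ∷_) (subsets N (suc k))))

length-subsets : ∀ N k → length (subsets N k) * k ! ≤ N ^ k
length-subsets zero    zero    = ≤-refl
length-subsets zero    (suc k) = z≤n
length-subsets (suc N) zero    =
  subst (λ l → l * 1 ≤ 1) (sym (length-map (outside ∷_) (subsets N zero))) (length-subsets N zero)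
length-subsets (suc N) (suc k) = begin
  length (subsets (suc N) (suc k)) * (suc k * k !) ≡⟨ cong (_* (suc k * k !)) (length-subsets-suc N k) ⟩
  (a + b) * (suc k * k !)                          ≡⟨ regroup a b (suc k) (k !) ⟩
  suc k * (a * k !) + b * (suc k * k !)            ≤⟨ +-mono-≤ (*-monoʳ-≤ (suc k) (length-subsets N k)) (length-subsets N (suc k)) ⟩
  suc k * N ^ k + N ^ suc k                        ≤⟨ bernoulli N k ⟩
  suc N ^ suc k                                    ∎
  where
  open ≤-Reasoning
  a = length (subsets N k)
  b = length (subsets N (suc k))
  regroup : ∀ a b c f → (a + b) * (c * f) ≡ c * (a * f) + b * (c * f)
  regroup = solve-∀

-- Sign matrices that are non-constant on every grid

∣++∣ : ∀ {M} (P : Subset M) (Q : Subset N) → ∣ P Vec.++ Q ∣ ≡ ∣ P ∣ + ∣ Q ∣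
∣++∣ []            Q = refl
∣++∣ (inside  ∷ P) Q = cong suc (∣++∣ P Q)
∣++∣ (outside ∷ P) Q = ∣++∣ P Q

-- The product of `S` and `D`, flattened row by row so that the pair of `r` and `i` sits at position
-- `combine r i`.
grid : ∀ {R} → Subset R → Subset L → Subset (R * L)
grid S D = concat (Vec.map (λ b → if b then D else ⊥) S)

∣grid∣ : ∀ {R} (S : Subset R) (D : Subset L) → ∣ grid S D ∣ ≡ ∣ S ∣ * ∣ D ∣
∣grid∣ []            D = refl
∣grid∣ (inside  ∷ S) D = trans (∣++∣ D (grid S D)) (cong (∣ D ∣ +_) (∣grid∣ S D))
∣grid∣ {L} (outside ∷ S) D = trans (∣++∣ (⊥ {L}) (grid S D)) (cong₂ _+_ (∣⊥∣≡0 L) (∣grid∣ S D))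

∈-grid⁻ : ∀ {R} (S : Subset R) (D : Subset L) r i → combine r i Subset.∈ grid S D → r Subset.∈ S × i Subset.∈ D
∈-grid⁻ S D r i p∈ = from (lookup S r) refl
  where
  restriction = λ b → if b then D else ⊥
  lookup-grid : lookup (restriction (lookup S r)) i ≡ inside
  lookup-grid = begin
    lookup (restriction (lookup S r)) i         ≡⟨ cong (λ P → lookup P i) (lookup-map r restriction S) ⟨
    lookup (lookup (Vec.map restriction S) r) i ≡⟨ lookup-concat (Vec.map restriction S) r i ⟨
    lookup (grid S D) (combine r i)             ≡⟨ []=⇒lookup p∈ ⟩
    inside                                      ∎
    where open ≡-Reasoning
  from : ∀ b → lookup S r ≡ b → r Subset.∈ S × i Subset.∈ D
  from inside  eq = lookup⇒[]= r S eq , lookup⇒[]= i D (subst (λ b → lookup (restriction b) i ≡ inside) eq lookup-grid)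
  from outside eq =
    contradiction (lookup⇒[]= i ⊥ (subst (λ b → lookup (restriction b) i ≡ inside) eq lookup-grid)) ∉⊥

length-cartesianProductWith : ∀ {A B C : Set} (f : A → B → C) xs ys →
  length (cartesianProductWith f xs ys) ≡ length xs * length ys
length-cartesianProductWith f []       ys = refl
length-cartesianProductWith f (x ∷ xs) ys = begin
  length (map (f x) ys ++ cartesianProductWith f xs ys)        ≡⟨ length-++ (map (f x) ys) ⟩
  length (map (f x) ys) + length (cartesianProductWith f xs ys) ≡⟨ cong₂ _+_ (length-map (f x) ys) (length-cartesianProductWith f xs ys) ⟩
  length ys + length xs * length ys                            ∎
  where open ≡-Reasoning

-- Union bound over both signs and all grids: each of these events fixes exactly `n * d` of the
-- `R * L` random signs.
non-constant-on-grids : ∀ R L n d → 2 * (length (subsets R n) * length (subsets L d)) < 2 ^ (n * d) →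
  ∃ λ (v : Fin R → Vec Bool L) → ∀ b (S : Subset R) (D : Subset L) → ∣ S ∣ ≡ n → ∣ D ∣ ≡ d →
    ∃₂ λ r i → r Subset.∈ S × i Subset.∈ D × lookup (v r) i ≢ b
non-constant-on-grids R L n d lt = Product.map rows (λ {v} → witness v) (avoiding events total<)
  where
  grids : List (Subset (R * L))
  grids = cartesianProductWith grid (subsets R n) (subsets L d)
  events : List (Event (R * L))
  events = cartesianProduct (true ∷ false ∷ []) grids
  length-events : length events ≡ 2 * (length (subsets R n) * length (subsets L d))
  length-events = trans (length-cartesianProductWith _,_ (true ∷ false ∷ []) grids)
    (cong (2 *_) (length-cartesianProductWith grid (subsets R n) (subsets L d)))
  grid-size : ∀ {Q} → Q ∈ grids → ∣ Q ∣ ≡ n * d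
  grid-size Q∈ with S , D , S∈ , D∈ , refl ← ∈-cartesianProductWith⁻ grid (subsets R n) (subsets L d) Q∈ =
    trans (∣grid∣ S D) (cong₂ _*_ (All.lookup (subsets-size R n) S∈) (All.lookup (subsets-size L d) D∈))
  total< : total events < 2 ^ (R * L)
  total< = *-cancelʳ-< (2 ^ (n * d)) _ _ (begin-strict
    total events * 2 ^ (n * d)    ≡⟨ total-uniform events (All.tabulate λ e∈ →
                                       grid-size (proj₂ (∈-cartesianProduct⁻ (true ∷ false ∷ []) grids e∈))) ⟩
    length events * 2 ^ (R * L)   <⟨ *-monoˡ-< (2 ^ (R * L)) {{m^n≢0 2 (R * L)}} (subst (_< 2 ^ (n * d)) (sym length-events) lt) ⟩
    2 ^ (n * d) * 2 ^ (R * L)     ≡⟨ *-comm (2 ^ (n * d)) _ ⟩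
    2 ^ (R * L) * 2 ^ (n * d)     ∎)
    where open ≤-Reasoning
  any-bool : ∀ b → b ∈ (true ∷ false ∷ [])
  any-bool true  = here refl
  any-bool false = there (here refl)
  rows : Vec Bool (R * L) → Fin R → Vec Bool L
  rows v r = Vec.tabulate (λ i → lookup v (combine r i))
  witness : ∀ v → All (Avoids v) events → ∀ b (S : Subset R) (D : Subset L) → ∣ S ∣ ≡ n → ∣ D ∣ ≡ d →
    ∃₂ λ r i → r Subset.∈ S × i Subset.∈ D × lookup (rows v r) i ≢ b
  witness v all b S D refl refl
    with p , p∈ , v≢ ← All.lookup all (∈-cartesianProduct⁺ (any-bool b)
           (∈-cartesianProductWith⁺ grid (∈-subsets⁺ S) (∈-subsets⁺ D)))
    with r , i , refl ← Fin.combine-surjective {R} {L} p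
    with r∈ , i∈ ← ∈-grid⁻ S D r i p∈
    = r , i , r∈ , i∈ , λ eq → v≢ (trans (sym (lookup∘tabulate _ i)) eq)

-- From submatrices to grids

insert : ∀ x (S : Subset N) → x Subset.∉ S →
  ∃ λ S′ → ∣ S′ ∣ ≡ suc ∣ S ∣ × (∀ {y} → y Subset.∈ S′ → y ≡ x ⊎ y Subset.∈ S)
insert zero    (inside  ∷ S) x∉ = contradiction here x∉
insert zero    (outside ∷ S) x∉ = inside ∷ S , refl , λ { here → inj₁ refl ; (there y∈) → inj₂ (there y∈) }
insert (suc x) (s ∷ S)       x∉ with S′ , size , cover ← insert x S (x∉ ∘ there) =
  s ∷ S′ , size′ s {S′} size , λ { here → inj₂ here ; (there y∈) → Sum.map (cong suc) there (cover y∈) }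
  where
  size′ : ∀ s {S′ : Subset _} → ∣ S′ ∣ ≡ suc ∣ S ∣ → ∣ s ∷ S′ ∣ ≡ suc ∣ s ∷ S ∣
  size′ inside  eq = cong suc eq
  size′ outside eq = eq

-- Converts a choice of rows into a `Subset`, keeping preimages so that a row found in the subset
-- can be traced back to the submatrix.
image : ∀ n (f : Fin n → Fin N) → (∀ {k l} → f k ≡ f l → k ≡ l) →
  ∃ λ S → ∣ S ∣ ≡ n × (∀ {r} → r Subset.∈ S → ∃ λ k → f k ≡ r)
image {N} zero    f inj = ⊥ , ∣⊥∣≡0 N , λ r∈ → contradiction r∈ ∉⊥
image     (suc n) f inj
  with S , refl , preimage ← image n (f ∘ suc) (Fin.suc-injective ∘ inj)
  with S′ , size , cover ← insert (f zero) S (λ f0∈ → Fin.0≢1+n (inj (sym (proj₂ (preimage f0∈)))))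
  = S′ , size , λ r∈ → [ (λ eq → zero , sym eq) , Product.map suc id ∘ preimage ]′ (cover r∈)

increasing⇒injective : ∀ {n} {f : Fin n → Fin N} → StrictlyIncreasing f → ∀ {k l} → f k ≡ f l → k ≡ l
increasing⇒injective inc {k} {l} eq with Fin.<-cmp k l
... | tri< k<l _ _ = contradiction (cong toℕ eq) (<⇒≢ (inc k l k<l))
... | tri≈ _ k≡l _ = k≡l
... | tri> _ _ l<k = contradiction (cong toℕ (sym eq)) (<⇒≢ (inc l k l<k))

increasing⇒reflects-< : ∀ {n} {f : Fin n → Fin N} → StrictlyIncreasing f → ∀ {k l} → f k Fin.< f l → k Fin.< l
increasing⇒reflects-< inc {k} {l} lt with Fin.<-cmp k l
... | tri< k<l _ _  = k<l
... | tri≈ _ refl _ = contradiction lt (<-irrefl refl)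
... | tri> _ _ l<k  = contradiction lt (<-asym (inc l k l<k))

-- A sign `false` complements the digit at its level, which reverses the lexicographic comparison
-- there; `binary` realizes the resulting order by integers.
orderMatrix : ∀ {R} → (Fin R → Vec Bool L) → Matrix R (2 ^ L)
orderMatrix s r c = ℤ.+ binary (zipWith orient (s r) (code c))

code-injective : {c c′ : Fin (2 ^ L)} → code {L} c ≡ code c′ → c ≡ c′
code-injective {L} {c} {c′} eq =
  Fin.toℕ-injective (trans (sym (binary-code L c)) (trans (cong binary eq) (binary-code L c′)))

-- The words of the chosen columns are distinct, so they split at `d` levels. A pair splitting at
-- level `i` rises or falls in row `r` according to the sign at `r` and `i`. Increasing rows force
-- every sign on the grid to be `true`, decreasing rows force `false`.
no-monotone-submatrix : ∀ {R n d} (s : Fin R → Vec Bool L) → 2 ^ d < 2 * n →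
  (∀ b (S : Subset R) (D : Subset L) → ∣ S ∣ ≡ n → ∣ D ∣ ≡ d →
    ∃₂ λ r i → r Subset.∈ S × i Subset.∈ D × lookup (s r) i ≢ b) →
  ¬ HasRowMonotoneSubmatrix n (orderMatrix s)
no-monotone-submatrix {L} {R} {n} {d} s lt non-constant (f , g , f-inc , g-inc , mono)
  with S , ∣S∣ , preimage ← image n f (increasing⇒injective f-inc)
  with D , ∣D∣ , split ← splitting-levels d (List.tabulate (code ∘ g))
         (Unique.tabulate⁺ (increasing⇒injective g-inc ∘ code-injective))
         (subst (λ l → 2 ^ d < 2 * l) (sym (length-tabulate (code ∘ g))) lt)
  = [ (λ inc → refute true (non-constant true S D ∣S∣ ∣D∣)
         λ r a a′ p a≤a′ eq → <⇒≱ (Splits⇒binary< (Splits-orient-flip (s (f r)) p (¬-not eq))) (drop‿+≤+ (inc r a a′ a≤a′)))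
    , (λ dec → refute false (non-constant false S D ∣S∣ ∣D∣)
         λ r a a′ p a≤a′ eq → <⇒≱ (Splits⇒binary< (Splits-orient (s (f r)) p (¬-not eq))) (drop‿+≤+ (dec r a a′ a≤a′)))
    ]′ mono
  where
  refute : ∀ b → (∃₂ λ r i → r Subset.∈ S × i Subset.∈ D × lookup (s r) i ≢ b) →
    (∀ k a a′ {i} → Splits i (code (g a)) (code (g a′)) → a Fin.≤ a′ → lookup (s (f k)) i ≢ b → Empty.⊥) → Empty.⊥
  refute b (r , i , r∈ , i∈ , s≢b) absurd
    with k , refl ← preimage r∈
    with x , y , x∈ , y∈ , p ← split i∈
    with a , refl ← ∈-tabulate⁻ x∈
    with a′ , refl ← ∈-tabulate⁻ y∈
    -- The pair is ordered by its codes, hence by column index, and `g` reflects this order, so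
    -- monotonicity applies to `a` and `a′` in that direction.
    = absurd k a a′ p (<⇒≤ (increasing⇒reflects-< g-inc
        (subst₂ _<_ (binary-code L (g a)) (binary-code L (g a′)) (Splits⇒binary< p)))) s≢b

-- Factorial estimate and the number of row choices

-- (1 + 1/n)^m ≤ 1 + m/n + (m/n)² for m ≤ n, cleared of denominators.
exp-bound : ∀ n m → m ≤ n → suc n ^ m * (n * n) ≤ n ^ m * (n * n + m * n + m * m)
exp-bound n zero    _   = ≤-reflexive (identity n)
  where
  identity : ∀ n → 1 * (n * n) ≡ 1 * (n * n + 0 + 0)
  identity = solve-∀
exp-bound n (suc m) m<n = begin
  suc n * suc n ^ m * (n * n)                            ≡⟨ *-assoc (suc n) (suc n ^ m) _ ⟩
  suc n * (suc n ^ m * (n * n))                          ≤⟨ *-monoʳ-≤ (suc n) (exp-bound n m (<⇒≤ m<n)) ⟩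
  suc n * (n ^ m * (n * n + m * n + m * m))              ≡⟨ expand n m (n ^ m) ⟩
  -- Here `m ≤ n` absorbs the leftover `m * m`; one more `n` then completes `suc m * suc m * n`.
  n ^ m * (X + m * m)                                    ≤⟨ *-monoʳ-≤ (n ^ m) (+-monoʳ-≤ X (*-monoʳ-≤ m (<⇒≤ m<n))) ⟩
  n ^ m * (X + m * n)                                    ≤⟨ *-monoʳ-≤ (n ^ m) (m≤m+n _ n) ⟩
  n ^ m * (X + m * n + n)                                ≡⟨ collect n m (n ^ m) ⟩
  n * n ^ m * (n * n + suc m * n + suc m * suc m)        ∎
  where
  open ≤-Reasoning
  X = n * n * n + m * n * n + m * m * n + n * n + m * n
  expand : ∀ n m x → (1 + n) * (x * (n * n + m * n + m * m)) ≡
    x * ((n * n * n + m * n * n + m * m * n + n * n + m * n) + m * m)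
  expand = solve-∀
  collect : ∀ n m x → x * ((n * n * n + m * n * n + m * m * n + n * n + m * n) + m * n + n) ≡
    n * x * (n * n + (1 + m) * n + (1 + m) * (1 + m))
  collect = solve-∀

-- The case `m = n` of `exp-bound`, where the three terms become equal; an elementary substitute for
-- the bound by Euler's e.
[1+n]^n≤3*n^n : ∀ n → suc n ^ n ≤ 3 * n ^ n
[1+n]^n≤3*n^n zero          = s≤s z≤n
[1+n]^n≤3*n^n n@(suc _) = *-cancelʳ-≤ _ _ (n * n) (begin
  suc n ^ n * (n * n)                 ≤⟨ exp-bound n n ≤-refl ⟩
  n ^ n * (n * n + n * n + n * n)     ≡⟨ identity (n ^ n) (n * n) ⟩
  3 * n ^ n * (n * n)                 ∎)
  where
  open ≤-Reasoning
  identity : ∀ x y → x * (y + y + y) ≡ 3 * x * y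
  identity = solve-∀

-- From `n` to `suc n` the ratio of `n ^ n` to `n !` grows by the factor (1 + 1/n)^n, which is at
-- most 3.
n^n≤3^n*n! : ∀ n → n ^ n ≤ 3 ^ n * n !
n^n≤3^n*n! zero    = ≤-refl
n^n≤3^n*n! (suc n) = begin
  suc n * suc n ^ n         ≤⟨ *-monoʳ-≤ (suc n) ([1+n]^n≤3*n^n n) ⟩
  suc n * (3 * n ^ n)       ≤⟨ *-monoʳ-≤ (suc n) (*-monoʳ-≤ 3 (n^n≤3^n*n! n)) ⟩
  suc n * (3 * (3 ^ n * n !)) ≡⟨ identity (suc n) (3 ^ n) (n !) ⟩
  3 * 3 ^ n * (suc n * n !) ∎
  where
  open ≤-Reasoning
  identity : ∀ m x y → m * (3 * (x * y)) ≡ 3 * x * (m * y)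
  identity = solve-∀

^-distribʳ-* : ∀ o m n → (m * n) ^ o ≡ m ^ o * n ^ o
^-distribʳ-* zero    m n = refl
^-distribʳ-* (suc o) m n =
  trans (cong (m * n *_) (^-distribʳ-* o m n)) (regroup m n (m ^ o) (n ^ o))
  where
  regroup : ∀ m n x y → m * n * (x * y) ≡ m * x * (n * y)
  regroup = solve-∀

-- Without denominators: a ≤ R^n / n! ≤ (n²/6)^n (3/n)^n = (n/2)^n. Of the factor 6, the 3 pays for
-- the factorial and the 2 leaves the spare `2 ^ n`.
row-choices : ∀ a n d R → a * n ! ≤ R ^ n → R * 6 ≤ n * n → n ≤ 2 ^ d → a * 2 ^ n ≤ 2 ^ (n * d)
row-choices a n d R a≤ R≤ n≤ = *-cancelʳ-≤ _ _ (3 ^ n * n !) {{m*n≢0 (3 ^ n) (n !) {{m^n≢0 3 n}} {{n !≢0}}}} (begin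
  a * 2 ^ n * (3 ^ n * n !)     ≡⟨ regroup a (2 ^ n) (3 ^ n) (n !) ⟩
  a * n ! * (2 ^ n * 3 ^ n)     ≡⟨ cong (a * n ! *_) (^-distribʳ-* n 2 3) ⟨
  a * n ! * 6 ^ n               ≤⟨ *-monoˡ-≤ (6 ^ n) a≤ ⟩
  R ^ n * 6 ^ n                 ≡⟨ ^-distribʳ-* n R 6 ⟨
  (R * 6) ^ n                   ≤⟨ ^-monoˡ-≤ n R≤ ⟩
  (n * n) ^ n                   ≡⟨ ^-distribʳ-* n n n ⟩
  n ^ n * n ^ n                 ≤⟨ *-mono-≤ (^-monoˡ-≤ n n≤) (n^n≤3^n*n! n) ⟩
  (2 ^ d) ^ n * (3 ^ n * n !)   ≡⟨ cong (_* (3 ^ n * n !)) (trans (^-*-assoc 2 d n) (cong (2 ^_) (*-comm d n))) ⟩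
  2 ^ (n * d) * (3 ^ n * n !)   ∎)
  where
  open ≤-Reasoning
  regroup : ∀ a x y z → a * x * (y * z) ≡ a * z * (x * y)
  regroup = solve-∀

-- Choice of the number of levels and final estimates

log₂-bracket : ∀ n → 2 ≤ n → ∃ λ e → 2 ^ e < n × n ≤ 2 ^ suc e
log₂-bracket 2 _ = 0 , ≤-refl , ≤-refl
log₂-bracket 1 (s≤s ())
log₂-bracket (suc n@(suc (suc _))) _ with e , lo , hi ← log₂-bracket n (s≤s (s≤s z≤n)) with m≤n⇒m<n∨m≡n hi
... | inj₁ n<2^d = e , m<n⇒m<1+n lo , n<2^d
... | inj₂ n≡2^d = suc e , s≤s (≤-reflexive (sym n≡2^d)) , (begin
  1 + n             ≤⟨ +-monoˡ-≤ n {1} {n} (s≤s z≤n) ⟩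
  n + n             ≡⟨ double n ⟨
  2 * n             ≡⟨ cong (2 *_) n≡2^d ⟩
  2 ^ suc (suc e)   ∎)
  where open ≤-Reasoning

-- Comparing exponents in (2^e)^(2k) ≤ n^(2k) ≤ 2^n gives 2ke ≤ n. As e ≥ 3, k(e + 1) ≤ 4ke/3 ≤
-- 2n/3, which leaves room for the extra 1. The factor 6 clears denominators.
exponent-bound : ∀ n k e → 9 ≤ n → n ^ (2 * k) ≤ 2 ^ n → 2 ^ e < n → n ≤ 2 ^ suc e → suc (k * suc e) < n
exponent-bound n k e 9≤n nk≤ lo hi = *-cancelˡ-< 6 _ _ (begin-strict
  6 * suc (k * suc e)                        ≡⟨ expand k e ⟩
  6 + 3 * (e * (2 * k)) + 3 * (2 * k)        ≤⟨ +-monoʳ-≤ (6 + 3 * (e * (2 * k))) (*-monoˡ-≤ (2 * k) 3≤e) ⟩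
  6 + 3 * (e * (2 * k)) + e * (2 * k)        ≡⟨ collect (e * (2 * k)) ⟩
  6 + 4 * (e * (2 * k))                      ≤⟨ +-monoʳ-≤ 6 (*-monoʳ-≤ 4 e*2k≤n) ⟩
  6 + 4 * n                                  <⟨ +-monoˡ-< (4 * n) (≤-trans (≤-trans (m≤m+n 7 2) 9≤n) (m≤m+n n _)) ⟩
  2 * n + 4 * n                              ≡⟨ *-distribʳ-+ n 2 4 ⟨
  6 * n                                      ∎)
  where
  open ≤-Reasoning
  e*2k≤n : e * (2 * k) ≤ n
  e*2k≤n = ≮⇒≥ λ n< → <⇒≱ (^-monoʳ-< 2 (s≤s (s≤s z≤n)) n<) (begin
    2 ^ (e * (2 * k))   ≡⟨ ^-*-assoc 2 e (2 * k) ⟨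
    (2 ^ e) ^ (2 * k)   ≤⟨ ^-monoˡ-≤ (2 * k) (<⇒≤ lo) ⟩
    n ^ (2 * k)         ≤⟨ nk≤ ⟩
    2 ^ n               ∎)
  3≤e : 3 ≤ e
  -- The source of the threshold 9: `e ≤ 2` would give `n ≤ 8`.
  3≤e = ≮⇒≥ λ e<3 → <⇒≱ 9≤n (≤-trans hi (^-monoʳ-≤ 2 e<3))
  expand : ∀ k e → 6 * (1 + k * (1 + e)) ≡ 6 + 3 * (e * (2 * k)) + 3 * (2 * k)
  expand = solve-∀
  collect : ∀ x → 6 + 3 * x + x ≡ 6 + 4 * x
  collect = solve-∀

few-grids : ∀ n k d → suc (k * d) < n → n ≤ 2 ^ d → let R = n * n / 6 in
  2 * (length (subsets R n) * length (subsets (2 ^ k) d)) < 2 ^ (n * d)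
few-grids n k d kd<n n≤ = begin-strict
  2 * (a * b)   ≡⟨ regroup a b ⟩
  a * (2 * b)   <⟨ a*2b< a refl ⟩
  2 ^ (n * d)   ∎
  where
  open ≤-Reasoning
  R = n * n / 6
  a = length (subsets R n)
  b = length (subsets (2 ^ k) d)
  regroup : ∀ a b → 2 * (a * b) ≡ a * (2 * b)
  regroup = solve-∀
  2b<2^n : 2 * b < 2 ^ n
  2b<2^n = begin-strict
    2 * b              ≤⟨ *-monoʳ-≤ 2 (m≤m*n b (d !) {{d !≢0}}) ⟩
    2 * (b * d !)      ≤⟨ *-monoʳ-≤ 2 (length-subsets (2 ^ k) d) ⟩
    2 * (2 ^ k) ^ d    ≡⟨ cong (2 *_) (^-*-assoc 2 k d) ⟩
    2 ^ suc (k * d)    <⟨ ^-monoʳ-< 2 (s≤s (s≤s z≤n)) kd<n ⟩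
    2 ^ n              ∎
  -- Multiplying a strict inequality needs a nonzero factor, so the case of no row choices is
  -- treated apart.
  a*2b< : ∀ a′ → a′ ≡ a → a′ * (2 * b) < 2 ^ (n * d)
  a*2b< zero       _  = m^n>0 2 (n * d)
  a*2b< a′@(suc _) eq = begin-strict
    a′ * (2 * b)  <⟨ *-monoʳ-< a′ 2b<2^n ⟩
    a′ * 2 ^ n    ≤⟨ row-choices a′ n d R (subst (λ x → x * n ! ≤ R ^ n) (sym eq) (length-subsets R n)) (m/n*n≤m (n * n) 6) n≤ ⟩
    2 ^ (n * d)   ∎

theorem3 : Σ ℕ λ N → ∀ (n k : ℕ) → N ≤ n → IsFloorNOver2Log2N n k →
    Σ (Matrix ((n * n) / 6) (2 ^ (2 ^ k))) λ A → ¬ HasRowMonotoneSubmatrix n A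
theorem3 = 9 , λ n k 9≤n (nk≤ , _) →
  let e , lo , hi = log₂-bracket n (≤-trans (m≤m+n 2 7) 9≤n)
      s , non-constant = non-constant-on-grids (n * n / 6) (2 ^ k) n (suc e)
        (few-grids n k (suc e) (exponent-bound n k e 9≤n nk≤ lo hi) hi)
  -- Doubling `2 ^ e < n` gives `2 ^ suc e < 2 * n`, the condition for `n` columns to split at
  -- `suc e` levels.
  in orderMatrix s , no-monotone-submatrix s (*-monoʳ-< 2 lo) non-constant
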